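{- Let $\mathbb{M} = \langle W, \{\sim_i\}_{i \in G}, \{\leq_{i,w}\}_{i \in G}^{w \in W}, V\rangle$ and $\mathbb{M}' = \langle W', \{\sim'_i\}_{i \in G}, \{\leq'_{i,w'}\}_{i \in G}^{w' \in W'}, V'\rangle$ be image-finite epistemic plausibility models. Then for all states $w\in W$ and $w'\in W'$: if $\mathbb{M},w\models\varphi\Leftrightarrow\mathbb{M}',w'\models\varphi$ for all $\varphi\in\mathcal{L}(K,B^c)$, then $w$ and $w'$ are $\{K,B^c\}$-bisimilar.
   Context: Fix a non-empty set $G$ of agents and a countably infinite set $Prop$ of proposition letters. Models. An epistemic plausibility model is a structure $\mathbb{M} = \langle W, \{\sim_i\}_{i \in G}, \{\leq_{i,w}\}_{i \in G}^{w \in W}, V\rangle$ where $W$ is a non-empty set of states, each $\sim_i \subseteq W\times W$ is an equivalence relation, each $\leq_{i,w} \subseteq W \times W$ is a well-founded pre-order, and $V : Prop \to \wp(W)$. For $X \subseteq W$, $\mathrm{Min}_{\leq_{i,w}}(X) := \{x \in X \mid \forall y \in X: y \leq_{i,w} x \Rightarrow x \leq_{i,w} y\}$. A well-founded pre-order is a reflexive transitive relation (not necessarily total) such that $\mathrm{Min}_{\leq_{i,w}}(X) \neq \emptyset$ for every non-empty $X \subseteq W$. Write $[w]_{\sim_i} := \{v \in W \mid w \sim_i v\}$. The model is image-finite if $[w]_{\sim_i}$ is finite for all $i\in G$ and $w\in W$. Language and semantics. $\mathcal{L}(K,B^c)$ is built from proposition letters $p\in Prop$ using $\neg$, $\wedge$,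 the unary operators $K_i$ and the binary operators $B_i^\alpha\varphi$ ($i\in G$; $\alpha,\varphi$ both formulas of the language). Proposition letters (via $V$) and Booleans are interpreted as usual; $[\![\alpha]\!]^{\mathbb{M}} := \{w \in W \mid \mathbb{M},w\models\alpha\}$; $\mathbb{M},w \models K_i\varphi$ iff $\forall v \in [w]_{\sim_i}: \mathbb{M},v\models\varphi$; $\mathbb{M},w \models B_i^\alpha\varphi$ iff $\forall v \in \mathrm{Min}_{\leq_{i,w}}([\![\alpha]\!]^{\mathbb{M}} \cap [w]_{\sim_i}): \mathbb{M},v\models\varphi$. Bisimulation. A relation $Z\subseteq W\times W'$ is a $\{K,B^c\}$-bisimulation iff for all $(w,w')\in Z$ and all $i\in G$: - for all $p\in Prop$: $w\in V(p)\Leftrightarrow w'\in V'(p)$; - if $w\sim_i v$, then there is $v'\in W'$ with $(v,v')\in Z$ and $w'\sim'_i v'$; and if $w'\sim'_i v'$, then there is $v\in W$ with $(v,v')\in Z$ and $w\sim_i v$; - for all formulas $\alpha\in\mathcal{L}(K,B^c)$: if $v\in \mathrm{Min}_{\leq_{i,w}}([\![\alpha]\!]^{\mathbb{M}}\cap[w]_{\sim_i})$, then there is $v'\in W'$ with $(v,v')\in Z$ and $v'\in \mathrm{Min}_{\leq'_{i,w'}}([\![\alpha]\!]^{\mathbb{M}'}\cap[w']_{\sim'_i})$; and if $v'\in \mathrm{Min}_{\leq'_{i,w'}}([\![\alpha]\!]^{\mathbb{M}'}\cap[w']_{\sim'_i})$, then there is $v\in W$ with $(v,v')\in Z$ and $v\in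 \mathrm{Min}_{\leq_{i,w}}([\![\alpha]\!]^{\mathbb{M}}\cap[w]_{\sim_i})$. States $w\in W$, $w'\in W'$ are $\{K,B^c\}$-bisimilar if there is a $\{K,B^c\}$-bisimulation $Z\subseteq W\times W'$ with $(w,w')\in Z$. -}

module Defs where

open import Level using (Level; suc)
open import Data.List.Base using (List)
import Data.List.Membership.Propositional as List
open import Data.Product using (_×_; ∃; ∃-syntax)
open import Function.Bundles using (_⇔_)
open import Relation.Binary.Core using (Rel; REL)
open import Relation.Binary.PropositionalEquality using (_≡_)
open import Relation.Binary.Structures using (IsEquivalence; IsPreorder)
open import Relation.Nullary using (¬_)
open import Relation.Unary using (Pred; _∈_; _∩_; Satisfiable)

private
  variable
    ℓ : Level

-- No totality is assumed, so this is not "y ≤ every element of X".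
Min : {A : Set ℓ} → Rel A ℓ → Pred A ℓ → Pred A ℓ
Min _≤_ X x = x ∈ X × (∀ y → y ∈ X → y ≤ x → x ≤ y)

-- Well-foundedness in the sense "every non-empty subset has a minimal
-- element"; the minimality is up to the equivalence induced by the pre-order.
record IsWellFoundedPreorder {A : Set ℓ} (_≤_ : Rel A ℓ) : Set (suc ℓ) where
  field
    isPreorder : IsPreorder _≡_ _≤_
    minimal    : ∀ (X : Pred A ℓ) → Satisfiable X → Satisfiable (Min _≤_ X)

-- Finite subsets: exactly the elements of some list (repetitions are harmless).
Finite : {A : Set ℓ} → Pred A ℓ → Set ℓ
Finite X = ∃[ xs ] (∀ x → x ∈ X ⇔ x List.∈ xs)

record Model {ℓ} (G Letter : Set ℓ) : Set (suc ℓ) where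
  field
    W             : Set ℓ
    inhabitant    : W
    _∼⟨_⟩_        : W → G → W → Set ℓ
    _≤⟨_,_⟩_      : W → G → W → W → Set ℓ
    V             : Letter → Pred W ℓ
    isEquivalence : ∀ i → IsEquivalence (λ w v → w ∼⟨ i ⟩ v)
    isWFPreorder  : ∀ i w → IsWellFoundedPreorder (λ u v → u ≤⟨ i , w ⟩ v)

  [_]∼ : W → G → Pred W ℓ
  [ w ]∼ i = λ v → w ∼⟨ i ⟩ v

  Best : G → W → Pred W ℓ → Pred W ℓ
  Best i w X = Min (λ u v → u ≤⟨ i , w ⟩ v) (X ∩ [ w ]∼ i)

data Formula {ℓ} (G Letter : Set ℓ) : Set ℓ where
  atom : Letter → Formula G Letter
  neg  : Formula G Letter → Formula G Letter
  _∧_  : Formula G Letter → Formula G Letter → Formula G Letter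
  K    : G → Formula G Letter → Formula G Letter
  -- B i α φ is B_i^α φ: the condition α comes first.
  B    : G → Formula G Letter → Formula G Letter → Formula G Letter

module _ {ℓ} {G Letter : Set ℓ} where

  open Model

  mutual
    _,_⊨_ : (M : Model G Letter) → W M → Formula G Letter → Set ℓ
    M , w ⊨ atom p  = w ∈ V M p
    M , w ⊨ neg φ   = ¬ (M , w ⊨ φ)
    M , w ⊨ (φ ∧ ψ) = (M , w ⊨ φ) × (M , w ⊨ ψ)
    M , w ⊨ K i φ   = ∀ v → v ∈ [_]∼ M w i → M , v ⊨ φ
    M , w ⊨ B i α φ = ∀ v → v ∈ Best M i w (⟦ α ⟧ M) → M , v ⊨ φ

    ⟦_⟧ : Formula G Letter → (M : Model G Letter) → Pred (W M) ℓ
    ⟦ α ⟧ M w = M , w ⊨ α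

  ImageFinite : Model G Letter → Set ℓ
  ImageFinite M = ∀ i w → Finite ([_]∼ M w i)

  module _ (M M′ : Model G Letter) where

    private
      module M  = Model M
      module M′ = Model M′

    record BisimulationConditions
      (Z : REL M.W M′.W ℓ) (w : M.W) (w′ : M′.W) (i : G) : Set ℓ where
      field
        atoms  : ∀ p → w ∈ M.V p ⇔ w′ ∈ M′.V p
        K-zig  : ∀ v → w M.∼⟨ i ⟩ v → ∃[ v′ ] (Z v v′ × w′ M′.∼⟨ i ⟩ v′)
        K-zag  : ∀ v′ → w′ M′.∼⟨ i ⟩ v′ → ∃[ v ] (Z v v′ × w M.∼⟨ i ⟩ v)
        Bᶜ-zig : ∀ α v → v ∈ M.Best i w (⟦ α ⟧ M) →
                 ∃[ v′ ] (Z v v′ × v′ ∈ M′.Best i w′ (⟦ α ⟧ M′))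
        Bᶜ-zag : ∀ α v′ → v′ ∈ M′.Best i w′ (⟦ α ⟧ M′) →
                 ∃[ v ] (Z v v′ × v ∈ M.Best i w (⟦ α ⟧ M))

    IsBisimulation : REL M.W M′.W ℓ → Set ℓ
    IsBisimulation Z = ∀ w w′ → Z w w′ → ∀ i → BisimulationConditions Z w w′ i

    Bisimilar : M.W → M′.W → Set (suc ℓ)
    Bisimilar w w′ = ∃[ Z ] (IsBisimulation Z × Z w w′)

{-# OPTIONS --safe #-}

-- Modal equivalence is itself a bisimulation.  If v ∈ X were equivalent to no
-- element of a finite set X′, then a conjunction δ of distinguishing formulas,
-- one per element of X′, would hold at v and fail throughout X′.  When the same
-- formulas hold throughout X as throughout X′, as they do for the ranges of a
-- modality K_i or B_i^α at equivalent states, ¬δ is a contradiction.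
module Submission where

open import Defs
open import Axiom.ExcludedMiddle using (ExcludedMiddle)
open import Axiom.DoubleNegationElimination using (em⇒dne)
open import Data.List.Base using ([]; _∷_)
open import Data.List.Membership.Propositional using () renaming (_∈_ to _∈ˡ_)
open import Data.List.Relation.Unary.Any using (here; there)
open import Data.Nat.Base using (ℕ)
open import Data.Product using (_×_; _,_; ∃-syntax; proj₁; proj₂)
open import Function.Base using (_∘_)
open import Function.Bundles using (_⇔_; _⤖_; Bijection; Equivalence; mk⇔)
open import Function.Construct.Symmetry using (⇔-sym)
open import Relation.Binary.Core using (REL)
open import Relation.Binary.PropositionalEquality using (refl)
open import Relation.Nullary using (¬_; yes; no; contradiction)
open import Relation.Unary using (Pred; _∈_; _⊆_)

open Model
open Equivalence using (to; from)

module _ {ℓ} {G Letter : Set ℓ} where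

  ModallyEquivalent : (M M′ : Model G Letter) → REL (W M) (W M′) ℓ
  ModallyEquivalent M M′ w w′ = ∀ φ → (M , w ⊨ φ) ⇔ (M′ , w′ ⊨ φ)

  ModallyEquivalent-sym : ∀ (M M′ : Model G Letter) {w w′} →
    ModallyEquivalent M M′ w w′ → ModallyEquivalent M′ M w′ w
  ModallyEquivalent-sym _ _ w≈w′ φ = ⇔-sym (w≈w′ φ)

  module _ (em : ExcludedMiddle ℓ) where

    -- The language is closed under negation, so preservation of all formulas from `v` to `v′`
    -- already gives equivalence: applied to `neg φ`, it reflects `φ` back.
    distinguish : ∀ (M M′ : Model G Letter) {v v′} →
      ¬ ModallyEquivalent M M′ v v′ →
      ∃[ δ ] ((M , v ⊨ δ) × ¬ (M′ , v′ ⊨ δ))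
    distinguish M M′ {v} {v′} v≉v′ = em⇒dne em λ none →
      let preserved : ∀ φ → M , v ⊨ φ → M′ , v′ ⊨ φ
          preserved φ v⊨φ = em⇒dne em λ v′⊭φ → none (φ , v⊨φ , v′⊭φ)
      in v≉v′ λ φ → mk⇔ (preserved φ) λ v′⊨φ →
           em⇒dne em λ v⊭φ → preserved (neg φ) v⊭φ v′⊨φ

    -- The letter is needed for a tautology, the empty conjunction.
    distinguish-all : Letter → ∀ (M M′ : Model G Letter) {v} (X′ : Pred (W M′) ℓ) →
      (∀ {x} → x ∈ X′ → ¬ ModallyEquivalent M M′ v x) → ∀ xs →
      ∃[ δ ] ((M , v ⊨ δ) × (∀ {x} → x ∈ˡ xs → x ∈ X′ → ¬ (M′ , x ⊨ δ)))
    distinguish-all p M M′ X′ v≉ [] =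
      neg (atom p ∧ neg (atom p)) , (λ (v⊨p , v⊭p) → v⊭p v⊨p) , λ ()
    distinguish-all p M M′ X′ v≉ (x ∷ xs)
      with distinguish-all p M M′ X′ v≉ xs | em {P = x ∈ X′}
    -- A listed state outside `X′` may well be equivalent to `v`, so it contributes no conjunct.
    ... | δ , v⊨δ , xs⊭δ | no x∉X′ = δ , v⊨δ , λ where
      (here refl)  x∈X′ → contradiction x∈X′ x∉X′
      (there y∈xs)      → xs⊭δ y∈xs
    ... | δ , v⊨δ , xs⊭δ | yes x∈X′ with distinguish M M′ (v≉ x∈X′)
    ... | ε , v⊨ε , x⊭ε = ε ∧ δ , (v⊨ε , v⊨δ) , λ where
      (here refl)  _    → x⊭ε ∘ proj₁
      (there y∈xs) y∈X′ → xs⊭δ y∈xs y∈X′ ∘ proj₂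

    -- The enumeration is of a superset `Y′` because image-finiteness lists a whole cell, whereas
    -- the minimal states in it come without a list of their own.
    equivalent-in-finite : Letter → ∀ (M M′ : Model G Letter)
      (X : Pred (W M) ℓ) (X′ : Pred (W M′) ℓ) {Y′ : Pred (W M′) ℓ} →
      Finite Y′ → X′ ⊆ Y′ →
      (∀ φ → (∀ v′ → v′ ∈ X′ → M′ , v′ ⊨ φ) → ∀ v → v ∈ X → M , v ⊨ φ) →
      ∀ v → v ∈ X → ∃[ v′ ] (ModallyEquivalent M M′ v v′ × v′ ∈ X′)
    equivalent-in-finite p M M′ X X′ (xs , enum) X′⊆Y′ transfer v v∈X =
      em⇒dne em λ none →
        let δ , v⊨δ , xs⊭δ = distinguish-all p M M′ X′
              (λ {x} x∈X′ v≈x → none (x , v≈x , x∈X′)) xs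
        in transfer (neg δ)
             (λ v′ v′∈X′ → xs⊭δ (to (enum v′) (X′⊆Y′ v′∈X′)) v′∈X′) v v∈X v⊨δ

    module _ (p : Letter) (M M′ : Model G Letter) (fin′ : ImageFinite M′)
             {w w′} (w≈w′ : ModallyEquivalent M M′ w w′) (i : G) where

      -- `K i φ` unfolds to truth of `φ` throughout the cell, so its equivalence at `w` and `w′`,
      -- read from right to left, is the transfer required.
      K-forth : ∀ v → v ∈ [_]∼ M w i →
        ∃[ v′ ] (ModallyEquivalent M M′ v v′ × v′ ∈ [_]∼ M′ w′ i)
      K-forth = equivalent-in-finite p M M′ ([_]∼ M w i) ([_]∼ M′ w′ i)
        (fin′ i w′) (λ w′∼v′ → w′∼v′) (λ φ → from (w≈w′ (K i φ)))

      Bᶜ-forth : ∀ α v → v ∈ Best M i w (⟦ α ⟧ M) →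
        ∃[ v′ ] (ModallyEquivalent M M′ v v′ × v′ ∈ Best M′ i w′ (⟦ α ⟧ M′))
      Bᶜ-forth α = equivalent-in-finite p M M′
        (Best M i w (⟦ α ⟧ M)) (Best M′ i w′ (⟦ α ⟧ M′))
        -- Minimal states lie in the cell of `w′`, which `fin′` enumerates.
        (fin′ i w′) (proj₂ ∘ proj₁) (λ φ → from (w≈w′ (B i α φ)))

    ModallyEquivalent-isBisimulation : Letter → ∀ (M M′ : Model G Letter) →
      ImageFinite M → ImageFinite M′ → IsBisimulation M M′ (ModallyEquivalent M M′)
    ModallyEquivalent-isBisimulation p M M′ fin fin′ w w′ w≈w′ i = record
      { atoms  = λ q → w≈w′ (atom q)
      ; K-zig  = K-forth p M M′ fin′ w≈w′ i
      -- The zag clauses are the forth lemmas with the two models exchanged, so here the finiteness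
      -- of the cells of `M` is used.
      ; K-zag  = λ v′ w′∼v′ → flipped (K-forth p M′ M fin w′≈w i v′ w′∼v′)
      ; Bᶜ-zig = Bᶜ-forth p M M′ fin′ w≈w′ i
      ; Bᶜ-zag = λ α v′ best → flipped (Bᶜ-forth p M′ M fin w′≈w i α v′ best)
      }
      where
      w′≈w = ModallyEquivalent-sym M M′ w≈w′

      flipped : ∀ {v′} {X : Pred (W M) ℓ} →
        ∃[ v ] (ModallyEquivalent M′ M v′ v × v ∈ X) →
        ∃[ v ] (ModallyEquivalent M M′ v v′ × v ∈ X)
      flipped (v , v′≈v , v∈X) = v , ModallyEquivalent-sym M′ M v′≈v , v∈X

theorem13 : ∀ {ℓ} → ExcludedMiddle ℓ →
    (G : Set ℓ) → G →
    (Letter : Set ℓ) → ℕ ⤖ Letter →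
    (M M′ : Model G Letter) → ImageFinite M → ImageFinite M′ →
    (w : Model.W M) (w′ : Model.W M′) →
    (∀ (φ : Formula G Letter) → (M , w ⊨ φ) ⇔ (M′ , w′ ⊨ φ)) →
    Bisimilar M M′ w w′
theorem13 em G _ Letter letters M M′ fin fin′ w w′ w≈w′ =
  ModallyEquivalent M M′ ,
  -- The image of 0 serves as the letter from which the tautology is built.
  ModallyEquivalent-isBisimulation em (Bijection.to letters 0) M M′ fin fin′ ,
  w≈w′
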